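{- Let $k\geq 1$ be an integer. For any integers $\delta$ and $\Delta$ such that $\Delta\geq \delta\geq k+2$, there exists an infinite family $\mathcal{F}$ of (pairwise non-isomorphic) graphs with minimum degree $\delta$ and maximum degree $\Delta$, such that for every graph $G\in \mathcal{F}$, $$\gamma^{t}_{kS}(G) = |V(G)|\cdot\frac{\delta-\Delta+2k+2-I_{\delta}-I_{\Delta}}{\delta+\Delta+I_{\Delta}-I_{\delta}}\;.$$
   Context: All graphs are finite, simple and undirected, with nonempty vertex set. For each integer $n$, $I_n=1$ if $n\equiv k\pmod 2$, and $I_n=0$ otherwise. For a vertex $v$ of $G$, $N_G(v)$ denotes the open neighborhood of $v$ (the set of vertices adjacent to $v$). For $G$ of minimum degree at least $k$, a function $f:V(G)\rightarrow\{ -1,1\}$ is a signed total $k$-dominating function of $G$ if $\sum_{u\in N_G(v)}f(u)\geq k$ for all $v\in V(G)$. The signed total $k$-domination number $\gamma^{t}_{kS}(G)$ is the minimum of $\sum_{v\in V(G)}f(v)$ over all signed total $k$-dominating functions $f$ of $G$. -}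

module Defs where

open import Data.Bool.Base using (true; false; if_then_else_)
open import Data.Fin.Base using (Fin)
open import Data.Integer.Base as ℤ using (ℤ; +_; _◃_)
open import Data.List.Base using (List; allFin; filter; foldr; length)
open import Data.Nat.Base as ℕ using (ℕ; suc)
import Data.Nat.Properties as ℕₚ
open import Data.Nat.DivMod using (_%_)
open import Data.Product.Base using (Σ-syntax; ∃-syntax; _×_)
open import Data.Rational.Base as ℚ using (ℚ)
import Data.Rational.Properties as ℚₚ
open import Data.Sign.Base using (Sign)
open import Function.Bundles using (_↔_; _⇔_; module Inverse)
open import Level using (0ℓ)
open import Relation.Binary.Core using (Rel)
open import Relation.Binary.Definitions using (Decidable; Symmetric)
open import Relation.Binary.PropositionalEquality using (_≡_)
open import Relation.Nullary using (¬_; does)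

record Graph : Set₁ where
  infix 4 _~_ _~?_
  field
    order    : ℕ
    nonEmpty : ℕ.NonZero order

  V : Set
  V = Fin order

  field
    _~_    : Rel V 0ℓ
    _~?_   : Decidable _~_
    sym    : Symmetric _~_
    irrefl : ∀ v → ¬ (v ~ v)

  vertices : List V
  vertices = allFin order

  N : V → List V
  N v = filter (v ~?_) vertices

  degree : V → ℕ
  degree v = length (N v)

infix 4 _≅_

record _≅_ (G H : Graph) : Set where
  private
    module G = Graph G
    module H = Graph H
  field
    bijection : G.V ↔ H.V
  open Inverse bijection using (to)
  field
    preserves : ∀ u v → (u G.~ v) ⇔ (to u H.~ to v)

HasMinDegree : Graph → ℕ → Set
HasMinDegree G δ = (∀ v → δ ℕ.≤ degree v) × (∃[ v ] degree v ≡ δ)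
  where open Graph G

HasMaxDegree : Graph → ℕ → Set
HasMaxDegree G Δ = (∀ v → degree v ℕ.≤ Δ) × (∃[ v ] degree v ≡ Δ)
  where open Graph G

-- A function V(G) → {-1, 1} is a function into Sign; s ◃ 1 is the value ±1.
signSum : {A : Set} → (A → Sign) → List A → ℤ
signSum f = foldr (λ u s → (f u ◃ 1) ℤ.+ s) (+ 0)

module _ (k : ℕ) (G : Graph) where
  open Graph G

  IsSignedTotalDominating : (V → Sign) → Set
  IsSignedTotalDominating f = ∀ v → + k ℤ.≤ signSum f (N v)

  weight : (V → Sign) → ℤ
  weight f = signSum f vertices

  -- γ is the minimum weight.  The minimum exists whenever the minimum
  -- degree of G is at least k (the constant function + is then dominating).
  IsSignedTotalDominationNumber : ℤ → Set
  IsSignedTotalDominationNumber γ =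
    (Σ[ f ∈ (V → Sign) ] IsSignedTotalDominating f × weight f ≡ γ) ×
    (∀ f → IsSignedTotalDominating f → γ ℤ.≤ weight f)

I : (k n : ℕ) → ℤ
I k n = if does (n % 2 ℕₚ.≟ k % 2) then + 1 else + 0

fromℤ : ℤ → ℚ
fromℤ i = i ℚ./ 1

numerator : (k δ Δ : ℕ) → ℤ
numerator k δ Δ = + δ ℤ.- + Δ ℤ.+ + 2 ℤ.* + k ℤ.+ + 2 ℤ.- I k δ ℤ.- I k Δ

denominator : (k δ Δ : ℕ) → ℤ
denominator k δ Δ = + δ ℤ.+ + Δ ℤ.+ I k Δ ℤ.- I k δ

denominator-positive : ∀ k δ Δ → 2 ℕ.≤ δ → δ ℕ.≤ Δ →
                       ℤ.Positive (denominator k δ Δ)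
denominator-positive k δ@(suc (suc _)) Δ@(suc _) (ℕ.s≤s (ℕ.s≤s _)) _
  with does (δ % 2 ℕₚ.≟ k % 2) | does (Δ % 2 ℕₚ.≟ k % 2)
... | true  | true  = _
... | true  | false = _
... | false | true  = _
... | false | false = _

fromℤ-nonZero : ∀ i → ℤ.Positive i → ℚ.NonZero (fromℤ i)
fromℤ-nonZero i@(+ suc n) _ =
  ℚₚ.pos⇒nonZero (fromℤ i) {{ℚₚ.normalize-pos (suc n) 1}}

denominator-nonZero : ∀ k δ Δ → k ℕ.+ 2 ℕ.≤ δ → δ ℕ.≤ Δ →
                      ℚ.NonZero (fromℤ (denominator k δ Δ))
denominator-nonZero k δ Δ k+2≤δ δ≤Δ =
  fromℤ-nonZero (denominator k δ Δ)
    (denominator-positive k δ Δ (ℕₚ.≤-trans (ℕₚ.m≤n+m 2 k) k+2≤δ) δ≤Δ)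

{-# OPTIONS --safe #-}

-- Under a signed total k-dominating function every negative vertex has at least
-- a = ⌈(δ+k)/2⌉ positive neighbours and every positive vertex at most b = ⌊(Δ-k)/2⌋
-- negative ones, so counting the edges between the two classes shows that at least the
-- fraction a/(a+b) of all vertices is positive; 2(a-b) and 2(a+b) are the numerator and
-- the denominator of the claimed ratio.  Equality holds as soon as some labelling makes all
-- positive vertices of degree Δ with exactly b negative neighbours, and all negative
-- vertices of degree δ with exactly a positive neighbours; such graphs are assembled from
-- complete graphs inside the classes and copies of K_{a,b} between them.

module Submission where

import Data.Nat.Properties as ℕₚ
open import Algebra.Properties.Semiring.Sum ℕₚ.+-*-semiring
  using (sum; sum-syntax; sum-cong-≗; sum-replicate-zero; ∑-distrib-+; ∑-comm;
         *-distribˡ-sum; *-distribʳ-sum)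
open import Data.Bool.Base using (true; false; if_then_else_)
open import Data.Fin.Base as Fin using (Fin; _↑ˡ_; _↑ʳ_; remQuot; combine)
import Data.Fin.Permutation as Permutation
import Data.Fin.Properties as Finₚ
open import Data.Integer.Base as ℤ using (ℤ; +_; _⊖_)
import Data.Integer.Properties as ℤₚ
import Data.Integer.Tactic.RingSolver as ℤ-Solver
open import Data.List.Base using (List; []; _∷_; filter; length; map; tabulate)
open import Data.Nat.Base as ℕ using (ℕ; zero; suc; _+_; _≤_; z≤n; s≤s)
import Data.Nat.ListAction as ListAction
open import Data.Nat.Tactic.RingSolver using (solve-∀)
open import Data.Product.Base using (Σ-syntax; ∃-syntax; _×_; _,_; proj₁; proj₂)
open import Data.Product.Function.NonDependent.Propositional using (_×-↔_)
open import Data.Product.Relation.Binary.Pointwise.NonDependent using (Pointwise; ×-decidable)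
open import Data.Rational.Base as ℚ using (_*_; _÷_; 1/_; toℚᵘ)
import Data.Rational.Properties as ℚₚ
import Data.Rational.Unnormalised.Base as ℚᵘ
import Data.Rational.Unnormalised.Properties as ℚᵘₚ
open import Data.Sign.Base as Sign using (Sign)
open import Data.Sum.Base using (_⊎_; inj₁; inj₂)
open import Data.Sum.Function.Propositional using (_⊎-↔_)
open import Data.Unit.Base using (⊤; tt)
open import Function.Base using (_∘_; _$_; id)
open import Function.Bundles using (_↔_; _⇔_; Equivalence; Inverse; mk⇔)
open import Function.Construct.Composition using (_↔-∘_)
open import Function.Construct.Identity using (↔-id)
open import Level using (0ℓ)
open import Relation.Binary.Core using (Rel)
open import Relation.Binary.Definitions using (Decidable; Symmetric)
open import Relation.Binary.PropositionalEquality
  using (_≡_; _≢_; refl; sym; trans; cong; cong₂; subst; subst₂; ≢-sym; module ≡-Reasoning)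
open import Relation.Nullary using (¬_; Dec; yes; does; ¬?; _×-dec_; contradiction)
open import Relation.Nullary.Decidable using (does-⇔)
import Relation.Unary as Unary
open import Defs

-- Indicators and finite sums.

𝟙 : {P : Set} → Dec P → ℕ
𝟙 P? = if does P? then 1 else 0

𝟙-cong : {P Q : Set} → P ⇔ Q → (P? : Dec P) (Q? : Dec Q) → 𝟙 P? ≡ 𝟙 Q?
𝟙-cong P⇔Q P? Q? = cong (if_then 1 else 0) (does-⇔ P⇔Q P? Q?)

𝟙-×-dec : {P Q : Set} (P? : Dec P) (Q? : Dec Q) → 𝟙 (P? ×-dec Q?) ≡ 𝟙 P? ℕ.* 𝟙 Q?
𝟙-×-dec P? Q? with does P? | does Q?
... | true  | true  = refl
... | true  | false = refl
... | false | _     = refl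

𝟙-¬? : {P : Set} (P? : Dec P) → 𝟙 (¬? P?) + 𝟙 P? ≡ 1
𝟙-¬? P? with does P?
... | true  = refl
... | false = refl

sum-mono-≤ : ∀ {n} {f g : Fin n → ℕ} → (∀ i → f i ≤ g i) → sum f ≤ sum g
sum-mono-≤ {zero}  f≤g = z≤n
sum-mono-≤ {suc n} f≤g = ℕₚ.+-mono-≤ (f≤g Fin.zero) (sum-mono-≤ (f≤g ∘ Fin.suc))

sum-const : ∀ n c → ∑[ i < n ] c ≡ n ℕ.* c
sum-const zero    c = refl
sum-const (suc n) c = cong (_+_ c) (sum-const n c)

sum-++ : ∀ m {n} (f : Fin (m + n) → ℕ) →
         sum f ≡ ∑[ i < m ] f (i ↑ˡ n) + ∑[ j < n ] f (m ↑ʳ j)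
sum-++ zero    f = refl
sum-++ (suc m) f =
  trans (cong (_+_ (f Fin.zero)) (sum-++ m (f ∘ Fin.suc))) (sym (ℕₚ.+-assoc (f Fin.zero) _ _))

sum-combine : ∀ m {n} (f : Fin (m ℕ.* n) → ℕ) →
              sum f ≡ ∑[ i < m ] ∑[ j < n ] f (combine i j)
sum-combine zero        f = refl
sum-combine (suc m) {n} f =
  trans (sum-++ n f) (cong (_+_ _) (sum-combine m (λ i → f (n ↑ʳ i))))

-- Sums and counts over enumerated types.

-- Vertices of a `Graph` are bare indices; summing through an enumeration lets a sum over them
-- follow the sum and product structure of `A`.
total : ∀ {n} {A : Set} → Fin n ↔ A → (A → ℕ) → ℕ
total e f = sum (f ∘ Inverse.to e)

total-cong : ∀ {n} {A : Set} (e : Fin n ↔ A) {f g : A → ℕ} →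
             (∀ x → f x ≡ g x) → total e f ≡ total e g
total-cong e f≗g = sum-cong-≗ (f≗g ∘ Inverse.to e)

infixr 1 _⊎ᵉ_
infixr 2 _×ᵉ_

_⊎ᵉ_ : ∀ {m n} {A B : Set} → Fin m ↔ A → Fin n ↔ B → Fin (m + n) ↔ (A ⊎ B)
d ⊎ᵉ e = (d ⊎-↔ e) ↔-∘ Finₚ.+↔⊎

_×ᵉ_ : ∀ {m n} {A B : Set} → Fin m ↔ A → Fin n ↔ B → Fin (m ℕ.* n) ↔ (A × B)
d ×ᵉ e = (d ×-↔ e) ↔-∘ Finₚ.*↔×

total-⊎ : ∀ {m n} {A B : Set} (d : Fin m ↔ A) (e : Fin n ↔ B) (f : A ⊎ B → ℕ) →
          total (d ⊎ᵉ e) f ≡ total d (f ∘ inj₁) + total e (f ∘ inj₂)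
total-⊎ {m} {n} d e f = trans (sum-++ m _) $ cong₂ _+_
  (sum-cong-≗ λ i → cong (f ∘ Inverse.to (d ⊎-↔ e)) (Finₚ.splitAt-↑ˡ m i n))
  (sum-cong-≗ λ j → cong (f ∘ Inverse.to (d ⊎-↔ e)) (Finₚ.splitAt-↑ʳ m n j))

total-× : ∀ {m n} {A B : Set} (d : Fin m ↔ A) (e : Fin n ↔ B) (f : A → ℕ) (g : B → ℕ) →
          total (d ×ᵉ e) (λ (x , y) → f x ℕ.* g y) ≡ total d f ℕ.* total e g
total-× {m} {n} d e f g = begin
  total (d ×ᵉ e) (λ (x , y) → f x ℕ.* g y)
    ≡⟨ sum-combine m _ ⟩
  ∑[ i < m ] ∑[ j < n ] h (remQuot n (combine i j))
    ≡⟨ (sum-cong-≗ λ i → sum-cong-≗ λ j → cong h (Finₚ.remQuot-combine {m} {n} i j)) ⟩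
  ∑[ i < m ] ∑[ j < n ] (f (Inverse.to d i) ℕ.* g (Inverse.to e j))
    ≡⟨ (sum-cong-≗ λ i → sym (*-distribˡ-sum (f (Inverse.to d i)) (g ∘ Inverse.to e))) ⟩
  ∑[ i < m ] (f (Inverse.to d i) ℕ.* total e g)
    ≡⟨ *-distribʳ-sum (total e g) (f ∘ Inverse.to d) ⟨
  total d f ℕ.* total e g
    ∎
  where
  open ≡-Reasoning
  h : Fin m × Fin n → ℕ
  h (i , j) = f (Inverse.to d i) ℕ.* g (Inverse.to e j)

count : ∀ {n} {A : Set} {P : A → Set} → Fin n ↔ A → Unary.Decidable P → ℕ
count e P? = total e (λ x → 𝟙 (P? x))

Regular : ∀ {n} {A : Set} {R : Rel A 0ℓ} → Fin n ↔ A → Decidable R → ℕ → Set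
Regular e R? d = ∀ x → count e (R? x) ≡ d

≟-regular : ∀ n → Regular (↔-id (Fin n)) Finₚ._≟_ 1
≟-regular (suc n) Fin.zero    = cong suc (sum-replicate-zero n)
≟-regular (suc n) (Fin.suc i) = ≟-regular n i

_≢?_ : ∀ {n} → Decidable {A = Fin n} _≢_
i ≢? j = ¬? (i Finₚ.≟ j)

-- The indicators of `≢` and `≡` add up to one at each of the `n + 1` points, and `≡` holds at
-- exactly one of them. In graph terms, the complete graph on `n + 1` points is `n`-regular.
≢?-regular : ∀ n → Regular (↔-id (Fin (suc n))) _≢?_ n
≢?-regular n i = ℕₚ.+-cancelʳ-≡ 1 (count e (i ≢?_)) n (begin
  count e (i ≢?_) + 1
    ≡⟨ cong (_+_ (count e (i ≢?_))) (≟-regular (suc n) i) ⟨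
  count e (i ≢?_) + count e (i Finₚ.≟_)
    ≡⟨ ∑-distrib-+ (λ j → 𝟙 (i ≢? j)) (λ j → 𝟙 (i Finₚ.≟ j)) ⟨
  ∑[ j < suc n ] (𝟙 (i ≢? j) + 𝟙 (i Finₚ.≟ j))
    ≡⟨ (sum-cong-≗ λ j → 𝟙-¬? (i Finₚ.≟ j)) ⟩
  ∑[ j < suc n ] 1
    ≡⟨ trans (sum-const (suc n) 1) (trans (ℕₚ.*-identityʳ (suc n)) (ℕₚ.+-comm 1 n)) ⟩
  n + 1
    ∎)
  where
  open ≡-Reasoning
  e = ↔-id (Fin (suc n))

count-× : ∀ {m n} {A B : Set} {P : A → Set} {Q : B → Set} (d : Fin m ↔ A) (e : Fin n ↔ B)
          (P? : Unary.Decidable P) (Q? : Unary.Decidable Q) →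
          count (d ×ᵉ e) (λ (x , y) → P? x ×-dec Q? y) ≡ count d P? ℕ.* count e Q?
count-× d e P? Q? = trans
  (total-cong (d ×ᵉ e) (λ (x , y) → 𝟙-×-dec (P? x) (Q? y)))
  (total-× d e (λ x → 𝟙 (P? x)) (λ y → 𝟙 (Q? y)))

-- Neighbours in a product are chosen coordinatewise, so degrees multiply. With equality as one
-- factor this handles disjoint copies of the other factor.
Pointwise-regular : ∀ {m n} {A B : Set} {R : Rel A 0ℓ} {S : Rel B 0ℓ}
                    (d : Fin m ↔ A) (e : Fin n ↔ B) (R? : Decidable R) (S? : Decidable S) {r s : ℕ} →
                    Regular d R? r → Regular e S? s →
                    Regular (d ×ᵉ e) (×-decidable R? S?) (r ℕ.* s)
Pointwise-regular d e R? S? R-reg S-reg (x , y) =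
  trans (count-× d e (R? x) (S? y)) (cong₂ ℕ._*_ (R-reg x) (S-reg y))

-- Signed sums as differences of natural numbers.

pos neg : Sign → ℕ
pos Sign.+ = 1
pos Sign.- = 0
neg Sign.+ = 0
neg Sign.- = 1

pos+neg : ∀ s → pos s + neg s ≡ 1
pos+neg Sign.+ = refl
pos+neg Sign.- = refl

∑ᴸ : {A : Set} → (A → ℕ) → List A → ℕ
∑ᴸ h xs = ListAction.sum (map h xs)

∑ᴸ-tabulate : ∀ {n} {A : Set} (h : A → ℕ) (g : Fin n → A) →
              ∑ᴸ h (tabulate g) ≡ sum (h ∘ g)
∑ᴸ-tabulate {zero}  h g = refl
∑ᴸ-tabulate {suc n} h g = cong (_+_ (h (g Fin.zero))) (∑ᴸ-tabulate h (g ∘ Fin.suc))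

-- Neighbourhoods are filtered lists of all vertices; this turns sums over them into indicator sums,
-- whose order of summation can be exchanged.
∑ᴸ-filter-tabulate : ∀ {n} {A : Set} {P : A → Set} (P? : Unary.Decidable P)
                     (h : A → ℕ) (g : Fin n → A) →
                     ∑ᴸ h (filter P? (tabulate g)) ≡ ∑[ i < n ] (𝟙 (P? (g i)) ℕ.* h (g i))
∑ᴸ-filter-tabulate {zero}  P? h g = refl
∑ᴸ-filter-tabulate {suc n} P? h g with does (P? (g Fin.zero))
... | true  = cong₂ _+_ (sym (ℕₚ.+-identityʳ _)) (∑ᴸ-filter-tabulate P? h (g ∘ Fin.suc))
... | false = ∑ᴸ-filter-tabulate P? h (g ∘ Fin.suc)

signSum-⊖ : {A : Set} (f : A → Sign) (xs : List A) →
            signSum f xs ≡ ∑ᴸ (pos ∘ f) xs ⊖ ∑ᴸ (neg ∘ f) xs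
signSum-⊖ f []       = refl
signSum-⊖ f (x ∷ xs) with f x
... | Sign.+ = trans (cong (ℤ._+_ (+ 1)) (signSum-⊖ f xs)) (ℤₚ.distribʳ-⊖-+-pos 1 (∑ᴸ (pos ∘ f) xs) (∑ᴸ (neg ∘ f) xs))
... | Sign.- = trans (cong (ℤ._+_ (ℤ.- + 1)) (signSum-⊖ f xs)) (ℤₚ.distribʳ-⊖-+-neg 0 (∑ᴸ (pos ∘ f) xs) (∑ᴸ (neg ∘ f) xs))

length-pos+neg : {A : Set} (f : A → Sign) (xs : List A) →
                 length xs ≡ ∑ᴸ (pos ∘ f) xs + ∑ᴸ (neg ∘ f) xs
length-pos+neg f []       = refl
length-pos+neg f (x ∷ xs) with f x
... | Sign.+ = cong suc (length-pos+neg f xs)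
... | Sign.- = trans (cong suc (length-pos+neg f xs)) (sym (ℕₚ.+-suc _ _))

m+n⊖n≡m : ∀ m n → m + n ⊖ n ≡ + m
m+n⊖n≡m m n = begin
  m + n ⊖ n        ≡⟨ cong (_⊖ n) (ℕₚ.+-comm m n) ⟩
  n + m ⊖ n        ≡⟨ ℤₚ.distribˡ-⊖-+-pos m n n ⟨
  n ⊖ n ℤ.+ + m    ≡⟨ cong (ℤ._+ + m) (ℤₚ.n⊖n≡0 n) ⟩
  + 0 ℤ.+ + m      ≡⟨ ℤₚ.+-identityˡ (+ m) ⟩
  + m              ∎
  where open ≡-Reasoning

-- Moves the domination condition from integers to natural numbers, where all the counting takes
-- place.
+≤⊖⇔ : ∀ k m n → (+ k ℤ.≤ m ⊖ n) ⇔ (k + n ≤ m)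
+≤⊖⇔ k m n = mk⇔ to from
  where
  to : + k ℤ.≤ m ⊖ n → k + n ≤ m
  to le = ℤₚ.drop‿+≤+ (subst (ℤ._≤_ (+ (k + n)))
    (trans (ℤₚ.distribˡ-⊖-+-pos n m n) (m+n⊖n≡m m n))
    (ℤₚ.+-monoˡ-≤ (+ n) le))
  from : k + n ≤ m → + k ℤ.≤ m ⊖ n
  from le = subst (ℤ._≤ (m ⊖ n)) (m+n⊖n≡m k n) (ℤₚ.⊖-monoˡ-≤ n le)

-- Counting edges between the classes; the lower bound on the weight.

module _ (G : Graph) (f : Graph.V G → Sign) where
  open Graph G hiding (sym)

  posNeighbours negNeighbours : V → ℕ
  posNeighbours v = ∑[ u < order ] (𝟙 (v ~? u) ℕ.* pos (f u))
  negNeighbours v = ∑[ u < order ] (𝟙 (v ~? u) ℕ.* neg (f u))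

  positives negatives : ℕ
  positives = ∑[ v < order ] pos (f v)
  negatives = ∑[ v < order ] neg (f v)

  degree-pos+neg : ∀ v → degree v ≡ posNeighbours v + negNeighbours v
  degree-pos+neg v = trans (length-pos+neg f (N v))
    (cong₂ _+_ (∑ᴸ-filter-tabulate (v ~?_) (pos ∘ f) id)
               (∑ᴸ-filter-tabulate (v ~?_) (neg ∘ f) id))

  signSum-N : ∀ v → signSum f (N v) ≡ posNeighbours v ⊖ negNeighbours v
  signSum-N v = trans (signSum-⊖ f (N v))
    (cong₂ _⊖_ (∑ᴸ-filter-tabulate (v ~?_) (pos ∘ f) id)
               (∑ᴸ-filter-tabulate (v ~?_) (neg ∘ f) id))

  weight-⊖ : ∀ k → weight k G f ≡ positives ⊖ negatives
  weight-⊖ k = trans (signSum-⊖ f vertices)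
    (cong₂ _⊖_ (∑ᴸ-tabulate (pos ∘ f) id) (∑ᴸ-tabulate (neg ∘ f) id))

  order-pos+neg : positives + negatives ≡ order
  order-pos+neg = begin
    positives + negatives                     ≡⟨ ∑-distrib-+ (pos ∘ f) (neg ∘ f) ⟨
    ∑[ v < order ] (pos (f v) + neg (f v))    ≡⟨ sum-cong-≗ (pos+neg ∘ f) ⟩
    ∑[ v < order ] 1                          ≡⟨ sum-const order 1 ⟩
    order ℕ.* 1                               ≡⟨ ℕₚ.*-identityʳ order ⟩
    order                                     ∎
    where open ≡-Reasoning

  -- Both sides count the edges between the two classes, once from the negative and once from the
  -- positive end; symmetry of adjacency matches the summands.
  edges-pos-neg : ∑[ v < order ] (neg (f v) ℕ.* posNeighbours v) ≡
                  ∑[ u < order ] (pos (f u) ℕ.* negNeighbours u)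
  edges-pos-neg = begin
    ∑[ v < order ] (neg (f v) ℕ.* posNeighbours v)
      ≡⟨ (sum-cong-≗ λ v → *-distribˡ-sum (neg (f v)) (λ u → 𝟙 (v ~? u) ℕ.* pos (f u))) ⟩
    ∑[ v < order ] ∑[ u < order ] (neg (f v) ℕ.* (𝟙 (v ~? u) ℕ.* pos (f u)))
      ≡⟨ ∑-comm (λ v u → neg (f v) ℕ.* (𝟙 (v ~? u) ℕ.* pos (f u))) ⟩
    ∑[ u < order ] ∑[ v < order ] (neg (f v) ℕ.* (𝟙 (v ~? u) ℕ.* pos (f u)))
      ≡⟨ (sum-cong-≗ λ u → sum-cong-≗ λ v → swap u v) ⟩
    ∑[ u < order ] ∑[ v < order ] (pos (f u) ℕ.* (𝟙 (u ~? v) ℕ.* neg (f v)))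
      ≡⟨ (sum-cong-≗ λ u → sym (*-distribˡ-sum (pos (f u)) (λ v → 𝟙 (u ~? v) ℕ.* neg (f v)))) ⟩
    ∑[ u < order ] (pos (f u) ℕ.* negNeighbours u)
      ∎
    where
    open ≡-Reasoning
    reverse : ∀ x y z → x ℕ.* (y ℕ.* z) ≡ z ℕ.* (y ℕ.* x)
    reverse = solve-∀
    swap : ∀ u v → neg (f v) ℕ.* (𝟙 (v ~? u) ℕ.* pos (f u)) ≡
                   pos (f u) ℕ.* (𝟙 (u ~? v) ℕ.* neg (f v))
    swap u v = trans (reverse (neg (f v)) (𝟙 (v ~? u)) (pos (f u)))
      (cong (λ e → pos (f u) ℕ.* (e ℕ.* neg (f v)))
        (𝟙-cong (mk⇔ (Graph.sym G) (Graph.sym G)) (v ~? u) (u ~? v)))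

  module _ {k : ℕ} (dominating : IsSignedTotalDominating k G f) where

    few-negative : ∀ v → k + negNeighbours v ≤ posNeighbours v
    few-negative v = Equivalence.to (+≤⊖⇔ k _ _)
      (subst (ℤ._≤_ (+ k)) (signSum-N v) (dominating v))

    -- With `p` positive and `m` negative neighbours, `p < a` gives `k + m ≤ p ≤ s + k`, hence
    -- `m ≤ s` and degree `p + m < a + s`, a contradiction.
    posNeighbours-≥ : ∀ {a s} → a ≤ suc (s + k) → (∀ v → a + s ≤ degree v) → ∀ v → a ≤ posNeighbours v
    posNeighbours-≥ {a} {s} a≤1+s+k δ≤ v = ℕₚ.≮⇒≥ λ p<a → ℕₚ.<⇒≱ (ℕₚ.+-mono-<-≤ p<a
      (ℕₚ.+-cancelˡ-≤ k _ _ (ℕₚ.≤-trans (few-negative v)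
        (ℕₚ.≤-trans (ℕ.s≤s⁻¹ (ℕₚ.≤-trans p<a a≤1+s+k)) (ℕₚ.≤-reflexive (ℕₚ.+-comm s k))))))
      (subst (_≤_ (a + s)) (degree-pos+neg v) (δ≤ v))

    -- With `p` positive and `m` negative neighbours, `b < m` gives `q ≤ m + k ≤ p`, hence degree
    -- `p + m > q + b`, a contradiction.
    negNeighbours-≤ : ∀ {q b} → q ≤ suc (b + k) → (∀ v → degree v ≤ q + b) → ∀ v → negNeighbours v ≤ b
    negNeighbours-≤ {q} {b} q≤1+b+k ≤Δ v = ℕₚ.≮⇒≥ λ b<m → ℕₚ.<⇒≱ (ℕₚ.+-mono-≤-<
      (ℕₚ.≤-trans q≤1+b+k (ℕₚ.≤-trans (ℕₚ.+-monoˡ-≤ k b<m)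
        (ℕₚ.≤-trans (ℕₚ.≤-reflexive (ℕₚ.+-comm _ k)) (few-negative v)))) b<m)
      (subst (_≤ (q + b)) (degree-pos+neg v) (≤Δ v))

    negatives*a≤positives*b : ∀ {a b} → (∀ v → a ≤ posNeighbours v) → (∀ v → negNeighbours v ≤ b) →
                              negatives ℕ.* a ≤ positives ℕ.* b
    negatives*a≤positives*b {a} {b} a≤ ≤b = begin
      negatives ℕ.* a
        ≡⟨ *-distribʳ-sum a (neg ∘ f) ⟩
      ∑[ v < order ] (neg (f v) ℕ.* a)
        ≤⟨ (sum-mono-≤ λ v → ℕₚ.*-monoʳ-≤ (neg (f v)) (a≤ v)) ⟩
      ∑[ v < order ] (neg (f v) ℕ.* posNeighbours v)
        ≡⟨ edges-pos-neg ⟩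
      ∑[ u < order ] (pos (f u) ℕ.* negNeighbours u)
        ≤⟨ (sum-mono-≤ λ u → ℕₚ.*-monoʳ-≤ (pos (f u)) (≤b u)) ⟩
      ∑[ u < order ] (pos (f u) ℕ.* b)
        ≡⟨ *-distribʳ-sum b (pos ∘ f) ⟨
      positives ℕ.* b
        ∎
      where open ℕₚ.≤-Reasoning

    -- The order fixes the sum of `positives` and `negatives`, so the weight is bounded below once
    -- `positives` is. Adding `positives * a` to both sides of the edge count gives
    -- `order * a ≤ positives * (a + b)`, and `a + b` cancels.
    weight-≥ : ∀ t a b .{{_ : ℕ.NonZero (a + b)}} → order ≡ t ℕ.* a + t ℕ.* b →
               (∀ v → a ≤ posNeighbours v) → (∀ v → negNeighbours v ≤ b) →
               t ℕ.* a ⊖ t ℕ.* b ℤ.≤ weight k G f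
    weight-≥ t a b order≡ a≤ ≤b = begin
      t ℕ.* a ⊖ t ℕ.* b        ≤⟨ ℤₚ.⊖-monoˡ-≤ (t ℕ.* b) positives-≥ ⟩
      positives ⊖ t ℕ.* b      ≤⟨ ℤₚ.⊖-monoʳ-≥-≤ positives negatives-≤ ⟩
      positives ⊖ negatives    ≡⟨ weight-⊖ k ⟨
      weight k G f             ∎
      where
      open ℤₚ.≤-Reasoning

      sum≡ : positives + negatives ≡ t ℕ.* a + t ℕ.* b
      sum≡ = trans order-pos+neg order≡

      factor : ∀ t a b → t ℕ.* a ℕ.* (a + b) ≡ (t ℕ.* a + t ℕ.* b) ℕ.* a
      factor = solve-∀

      positives-≥ : t ℕ.* a ≤ positives
      positives-≥ = ℕₚ.*-cancelʳ-≤ (t ℕ.* a) positives (a + b) scaled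
        where
        scaled : t ℕ.* a ℕ.* (a + b) ≤ positives ℕ.* (a + b)
        scaled rewrite factor t a b
                     | sym sum≡
                     | ℕₚ.*-distribʳ-+ a positives negatives
                     | ℕₚ.*-distribˡ-+ positives a b =
          ℕₚ.+-monoʳ-≤ (positives ℕ.* a) (negatives*a≤positives*b a≤ ≤b)

      negatives-≤ : negatives ≤ t ℕ.* b
      negatives-≤ = ℕₚ.+-cancelˡ-≤ (t ℕ.* a) negatives (t ℕ.* b)
        (ℕₚ.≤-trans (ℕₚ.+-monoˡ-≤ negatives positives-≥) (ℕₚ.≤-reflexive sum≡))

-- The extremal graphs and their signed total domination number.

-- Each of the suc a positive and suc b negative layers is a copy of C.  Within a positive
-- (negative) layer the edges form disjoint copies of K_{q+1} (of K_{s+1}); a positive and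
-- a negative vertex are adjacent iff they lie over the same point of C.
module Construction (a b q s c : ℕ) where

  -- The first coordinate runs through a copy of K_{q+1}, the second through a copy of K_{s+1}.
  -- Every adjacency preserves the third, which therefore indexes `suc c` disjoint copies of one
  -- graph and makes the family infinite.
  C : Set
  C = Fin (suc q) × Fin (suc s) × Fin (suc c)

  t : ℕ
  t = suc q ℕ.* (suc s ℕ.* suc c)

  enumC : Fin t ↔ C
  enumC = ↔-id _ ×ᵉ ↔-id _ ×ᵉ ↔-id _

  _~⁺_ _~⁻_ _≈_ : Rel C 0ℓ
  _~⁺_ = Pointwise _≢_ (Pointwise _≡_ _≡_)
  _~⁻_ = Pointwise _≡_ (Pointwise _≢_ _≡_)
  _≈_  = Pointwise _≡_ (Pointwise _≡_ _≡_)

  _~⁺?_ : Decidable _~⁺_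
  _~⁺?_ = ×-decidable _≢?_ (×-decidable Finₚ._≟_ Finₚ._≟_)

  _~⁻?_ : Decidable _~⁻_
  _~⁻?_ = ×-decidable Finₚ._≟_ (×-decidable _≢?_ Finₚ._≟_)

  _≈?_ : Decidable _≈_
  _≈?_ = ×-decidable Finₚ._≟_ (×-decidable Finₚ._≟_ Finₚ._≟_)

  ~⁺?-regular : Regular enumC _~⁺?_ q
  ~⁺?-regular x = trans
    (Pointwise-regular (↔-id _) (↔-id _ ×ᵉ ↔-id _) _≢?_ (×-decidable Finₚ._≟_ Finₚ._≟_) (≢?-regular q)
      (Pointwise-regular (↔-id _) (↔-id _) Finₚ._≟_ Finₚ._≟_ (≟-regular (suc s)) (≟-regular (suc c))) x)
    (ℕₚ.*-identityʳ q)

  ~⁻?-regular : Regular enumC _~⁻?_ s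
  ~⁻?-regular x = trans
    (Pointwise-regular (↔-id _) (↔-id _ ×ᵉ ↔-id _) Finₚ._≟_ (×-decidable _≢?_ Finₚ._≟_) (≟-regular (suc q))
      (Pointwise-regular (↔-id _) (↔-id _) _≢?_ Finₚ._≟_ (≢?-regular s) (≟-regular (suc c))) x)
    (trans (ℕₚ.*-identityˡ (s ℕ.* 1)) (ℕₚ.*-identityʳ s))

  ≈?-regular : Regular enumC _≈?_ 1
  ≈?-regular =
    Pointwise-regular (↔-id _) (↔-id _ ×ᵉ ↔-id _) Finₚ._≟_ (×-decidable Finₚ._≟_ Finₚ._≟_) (≟-regular (suc q))
      (Pointwise-regular (↔-id _) (↔-id _) Finₚ._≟_ Finₚ._≟_ (≟-regular (suc s)) (≟-regular (suc c)))

  Vertex : Set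
  Vertex = (C × Fin (suc a)) ⊎ (C × Fin (suc b))

  enum⁺ : Fin (t ℕ.* suc a) ↔ (C × Fin (suc a))
  enum⁺ = enumC ×ᵉ ↔-id _

  enum⁻ : Fin (t ℕ.* suc b) ↔ (C × Fin (suc b))
  enum⁻ = enumC ×ᵉ ↔-id _

  enum : Fin (t ℕ.* suc a + t ℕ.* suc b) ↔ Vertex
  enum = enum⁺ ⊎ᵉ enum⁻

  -- The factor `⊤` gives the mixed cases the same product shape as the others, so that `count-×`
  -- applies to all four.
  Adjacent : Rel Vertex 0ℓ
  Adjacent (inj₁ (x , i)) (inj₁ (y , j)) = x ~⁺ y × i ≡ j
  Adjacent (inj₁ (x , _)) (inj₂ (y , _)) = x ≈ y × ⊤
  Adjacent (inj₂ (x , _)) (inj₁ (y , _)) = x ≈ y × ⊤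
  Adjacent (inj₂ (x , i)) (inj₂ (y , j)) = x ~⁻ y × i ≡ j

  adjacent? : Decidable Adjacent
  adjacent? (inj₁ (x , i)) (inj₁ (y , j)) = x ~⁺? y ×-dec i Finₚ.≟ j
  adjacent? (inj₁ (x , _)) (inj₂ (y , _)) = x ≈? y ×-dec yes tt
  adjacent? (inj₂ (x , _)) (inj₁ (y , _)) = x ≈? y ×-dec yes tt
  adjacent? (inj₂ (x , i)) (inj₂ (y , j)) = x ~⁻? y ×-dec i Finₚ.≟ j

  ≈-sym : Symmetric _≈_
  ≈-sym (p , q , r) = sym p , sym q , sym r

  Adjacent-sym : ∀ u v → Adjacent u v → Adjacent v u
  Adjacent-sym (inj₁ _) (inj₁ _) ((p , q , r) , e) = (≢-sym p , sym q , sym r) , sym e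
  Adjacent-sym (inj₁ _) (inj₂ _) (p , _)           = ≈-sym p , tt
  Adjacent-sym (inj₂ _) (inj₁ _) (p , _)           = ≈-sym p , tt
  Adjacent-sym (inj₂ _) (inj₂ _) ((p , q , r) , e) = (sym p , ≢-sym q , sym r) , sym e

  Adjacent-irrefl : ∀ u → ¬ Adjacent u u
  Adjacent-irrefl (inj₁ _) ((p , _) , _)     = p refl
  Adjacent-irrefl (inj₂ _) ((_ , q , _) , _) = q refl

  vertex : Fin (t ℕ.* suc a + t ℕ.* suc b) → Vertex
  vertex = Inverse.to enum

  graph : Graph
  graph = record
    { order    = t ℕ.* suc a + t ℕ.* suc b
    -- The order is built from successors and computes to a successor, so the witness is trivial.
    ; nonEmpty = _
    ; _~_      = λ u v → Adjacent (vertex u) (vertex v)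
    ; _~?_     = λ u v → adjacent? (vertex u) (vertex v)
    ; sym      = λ {u} {v} → Adjacent-sym (vertex u) (vertex v)
    ; irrefl   = λ v → Adjacent-irrefl (vertex v)
    }

  sign : Vertex → Sign
  sign (inj₁ _) = Sign.+
  sign (inj₂ _) = Sign.-

  labelling : Graph.V graph → Sign
  labelling = sign ∘ vertex

  degree⁺ degree⁻ : Vertex → ℕ
  degree⁺ (inj₁ _) = q
  degree⁺ (inj₂ _) = suc a
  degree⁻ (inj₁ _) = suc b
  degree⁻ (inj₂ _) = s

  count⁺ : ∀ x → count enum⁺ (λ y → adjacent? x (inj₁ y)) ≡ degree⁺ x
  count⁺ (inj₁ (x , i)) = trans (count-× enumC (↔-id _) (x ~⁺?_) (i Finₚ.≟_))
    (trans (cong₂ ℕ._*_ (~⁺?-regular x) (≟-regular (suc a) i)) (ℕₚ.*-identityʳ q))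
  count⁺ (inj₂ (x , _)) = trans (count-× enumC (↔-id (Fin (suc a))) (x ≈?_) (λ _ → yes tt))
    (trans (cong₂ ℕ._*_ (≈?-regular x) (trans (sum-const (suc a) 1) (ℕₚ.*-identityʳ (suc a))))
           (ℕₚ.*-identityˡ (suc a)))

  count⁻ : ∀ x → count enum⁻ (λ y → adjacent? x (inj₂ y)) ≡ degree⁻ x
  count⁻ (inj₁ (x , _)) = trans (count-× enumC (↔-id (Fin (suc b))) (x ≈?_) (λ _ → yes tt))
    (trans (cong₂ ℕ._*_ (≈?-regular x) (trans (sum-const (suc b) 1) (ℕₚ.*-identityʳ (suc b))))
           (ℕₚ.*-identityˡ (suc b)))
  count⁻ (inj₂ (x , i)) = trans (count-× enumC (↔-id _) (x ~⁻?_) (i Finₚ.≟_))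
    (trans (cong₂ ℕ._*_ (~⁻?-regular x) (≟-regular (suc b) i)) (ℕₚ.*-identityʳ s))

  total-*0 : ∀ {n} {A : Set} (e : Fin n ↔ A) (f : A → ℕ) → total e (λ x → f x ℕ.* 0) ≡ 0
  total-*0 e f = trans (sym (*-distribʳ-sum 0 (f ∘ Inverse.to e))) (ℕₚ.*-zeroʳ (total e f))

  posNeighbours-labelling : ∀ v → posNeighbours graph labelling v ≡ degree⁺ (vertex v)
  posNeighbours-labelling v = begin
    posNeighbours graph labelling v
      ≡⟨ total-⊎ enum⁺ enum⁻ (λ y → 𝟙 (adjacent? x y) ℕ.* pos (sign y)) ⟩
    total enum⁺ (λ y → 𝟙 (adjacent? x (inj₁ y)) ℕ.* 1) + total enum⁻ (λ y → 𝟙 (adjacent? x (inj₂ y)) ℕ.* 0)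
      ≡⟨ cong₂ _+_ (total-cong enum⁺ (λ y → ℕₚ.*-identityʳ (𝟙 (adjacent? x (inj₁ y)))))
                   (total-*0 enum⁻ (λ y → 𝟙 (adjacent? x (inj₂ y)))) ⟩
    count enum⁺ (λ y → adjacent? x (inj₁ y)) + 0
      ≡⟨ ℕₚ.+-identityʳ _ ⟩
    count enum⁺ (λ y → adjacent? x (inj₁ y))
      ≡⟨ count⁺ x ⟩
    degree⁺ x
      ∎
    where
    open ≡-Reasoning
    x = vertex v

  negNeighbours-labelling : ∀ v → negNeighbours graph labelling v ≡ degree⁻ (vertex v)
  negNeighbours-labelling v = begin
    negNeighbours graph labelling v
      ≡⟨ total-⊎ enum⁺ enum⁻ (λ y → 𝟙 (adjacent? x y) ℕ.* neg (sign y)) ⟩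
    total enum⁺ (λ y → 𝟙 (adjacent? x (inj₁ y)) ℕ.* 0) + total enum⁻ (λ y → 𝟙 (adjacent? x (inj₂ y)) ℕ.* 1)
      ≡⟨ cong₂ _+_ (total-*0 enum⁺ (λ y → 𝟙 (adjacent? x (inj₁ y))))
                   (total-cong enum⁻ (λ y → ℕₚ.*-identityʳ (𝟙 (adjacent? x (inj₂ y))))) ⟩
    count enum⁻ (λ y → adjacent? x (inj₂ y))
      ≡⟨ count⁻ x ⟩
    degree⁻ x
      ∎
    where
    open ≡-Reasoning
    x = vertex v

  degree-graph : ∀ v → Graph.degree graph v ≡ degree⁺ (vertex v) + degree⁻ (vertex v)
  degree-graph v = trans (degree-pos+neg graph labelling v)
    (cong₂ _+_ (posNeighbours-labelling v) (negNeighbours-labelling v))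

  degree-surjective : ∀ x → ∃[ v ] Graph.degree graph v ≡ degree⁺ x + degree⁻ x
  degree-surjective x = Inverse.from enum x , trans (degree-graph (Inverse.from enum x))
    (cong (λ y → degree⁺ y + degree⁻ y) (Inverse.strictlyInverseˡ enum x))

  weight-labelling : ∀ k → weight k graph labelling ≡ t ℕ.* suc a ⊖ t ℕ.* suc b
  weight-labelling k = trans (weight-⊖ graph labelling k) (cong₂ _⊖_
    (trans (total-⊎ enum⁺ enum⁻ (pos ∘ sign)) (trans (cong₂ _+_ (total-1 enum⁺) (total-0 enum⁻)) (ℕₚ.+-identityʳ _)))
    (trans (total-⊎ enum⁺ enum⁻ (neg ∘ sign)) (cong₂ _+_ (total-0 enum⁺) (total-1 enum⁻))))
    where
    total-1 : ∀ {n} {A : Set} (e : Fin n ↔ A) → total e (λ _ → 1) ≡ n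
    total-1 {n} e = trans (sum-const n 1) (ℕₚ.*-identityʳ n)
    total-0 : ∀ {n} {A : Set} (e : Fin n ↔ A) → total e (λ _ → 0) ≡ 0
    total-0 {n} e = sum-replicate-zero n

  module _ {δ Δ : ℕ} (δ≡ : suc a + s ≡ δ) (Δ≡ : q + suc b ≡ Δ) (δ≤Δ : δ ≤ Δ) where

    degree-bounds : ∀ v → δ ≤ Graph.degree graph v × Graph.degree graph v ≤ Δ
    degree-bounds v rewrite degree-graph v with vertex v
    ... | inj₁ _ = subst (δ ≤_) (sym Δ≡) δ≤Δ , ℕₚ.≤-reflexive Δ≡
    ... | inj₂ _ = ℕₚ.≤-reflexive (sym δ≡) , subst (_≤ Δ) (sym δ≡) δ≤Δ

    origin : C
    origin = Fin.zero , Fin.zero , Fin.zero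

    hasMinDegree : HasMinDegree graph δ
    hasMinDegree = proj₁ ∘ degree-bounds ,
      (let v , deg≡ = degree-surjective (inj₂ (origin , Fin.zero)) in v , trans deg≡ δ≡)

    hasMaxDegree : HasMaxDegree graph Δ
    hasMaxDegree = proj₂ ∘ degree-bounds ,
      (let v , deg≡ = degree-surjective (inj₁ (origin , Fin.zero)) in v , trans deg≡ Δ≡)

    -- The bounds `k + s ≤ suc a` and `k + suc b ≤ q` make `labelling` dominating at negative and at
    -- positive vertices. The other two force at least `suc a` positive and at most `suc b` negative
    -- neighbours under any dominating function, so `weight-≥` applies with the weight of
    -- `labelling` as its bound.
    dominationNumber : ∀ {k} → k + s ≤ suc a → suc a ≤ suc (s + k) →
                       k + suc b ≤ q → q ≤ suc (suc b + k) →
                       IsSignedTotalDominationNumber k graph (t ℕ.* suc a ⊖ t ℕ.* suc b)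
    dominationNumber {k} k+s≤a a≤1+s+k k+b≤q q≤1+b+k =
      (labelling , dominating , weight-labelling k) , λ f f-dominating →
        weight-≥ graph f f-dominating t (suc a) (suc b) refl
          (posNeighbours-≥ graph f f-dominating a≤1+s+k
            λ v → subst (_≤ Graph.degree graph v) (sym δ≡) (proj₁ (degree-bounds v)))
          (negNeighbours-≤ graph f f-dominating q≤1+b+k
            λ v → subst (Graph.degree graph v ≤_) (sym Δ≡) (proj₂ (degree-bounds v)))
      where
      majority : ∀ x → k + degree⁻ x ≤ degree⁺ x
      majority (inj₁ _) = k+b≤q
      majority (inj₂ _) = k+s≤a
      dominating : IsSignedTotalDominating k graph labelling
      dominating v = subst (ℤ._≤_ (+ k)) (sym (signSum-N graph labelling v))
        (Equivalence.from (+≤⊖⇔ k _ _)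
          (subst₂ _≤_ (cong (_+_ k) (sym (negNeighbours-labelling v)))
                      (sym (posNeighbours-labelling v)) (majority (vertex v))))

-- Isomorphic graphs have the same order, and the order is `suc c` times a positive factor
-- independent of `c`.
graph-injective : ∀ a b q s {c d} →
                  Construction.graph a b q s c ≅ Construction.graph a b q s d → c ≡ d
graph-injective a b q s {c} {d} iso = ℕₚ.suc-injective
  (ℕₚ.*-cancelˡ-≡ (suc c) (suc d) (suc s)
    (ℕₚ.*-cancelˡ-≡ _ _ (suc q)
      (ℕₚ.*-cancelʳ-≡ (t c) (t d) (suc a + suc b)
        (trans (ℕₚ.*-distribˡ-+ (t c) (suc a) (suc b))
          (trans (Permutation.↔⇒≡ (_≅_.bijection iso))
            (sym (ℕₚ.*-distribˡ-+ (t d) (suc a) (suc b))))))))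
  where open Construction a b q s using (t)

-- Parity and the neighbour thresholds.

-- q and r are the least number of positive and the greatest number of negative neighbours
-- of a vertex of degree n under a signed total k-dominating function.
parity-split : ∀ k n → k ≤ n →
  ∃[ q ] ∃[ r ] ∃[ i ] q + r ≡ n × q + i ≡ suc (k + r) × i ≤ 1 × I k n ≡ + i
parity-split 0 0 _ = 0 , 0 , 1 , refl , refl , s≤s z≤n , refl
parity-split 0 1 _ = 1 , 0 , 0 , refl , refl , z≤n , refl
-- Raising `n` by two keeps its parity and raises both thresholds by one.
parity-split 0 (suc (suc n)) _ =
  let q , r , i , n≡ , q+i≡ , i≤1 , I≡ = parity-split 0 n z≤n
  in suc q , suc r , i , cong suc (trans (ℕₚ.+-suc q r) (cong suc n≡)) , cong suc q+i≡ , i≤1 , I≡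
parity-split 1 1 _ = 1 , 0 , 1 , refl , refl , s≤s z≤n , refl
-- A base case: two steps down would leave `n = 0`, below `k = 1`.
parity-split 1 2 _ = 2 , 0 , 0 , refl , refl , z≤n , refl
parity-split 1 (suc (suc n@(suc _))) _ =
  let q , r , i , n≡ , q+i≡ , i≤1 , I≡ = parity-split 1 n (s≤s z≤n)
  in suc q , suc r , i , cong suc (trans (ℕₚ.+-suc q r) (cong suc n≡)) , cong suc q+i≡ , i≤1 , I≡
-- Raising `k` and `n` together by two raises only the positive threshold, by two.
parity-split (suc (suc k)) (suc (suc n)) (s≤s (s≤s k≤n)) =
  let q , r , i , n≡ , q+i≡ , i≤1 , I≡ = parity-split k n k≤n
  in suc (suc q) , r , i , cong (suc ∘ suc) n≡ , cong (suc ∘ suc) q+i≡ , i≤1 , I≡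

-- Integer ratios inside the rationals.

-- In the unnormalised rationals the product of two fractions with denominator 1 computes without
-- any reduction by a gcd.
fromℤ-* : ∀ i j → fromℤ (i ℤ.* j) ≡ fromℤ i * fromℤ j
fromℤ-* i j = ℚₚ.toℚᵘ-injective (begin
  toℚᵘ (fromℤ (i ℤ.* j))                ≈⟨ ℚₚ.toℚᵘ-fromℚᵘ (ℚᵘ.mkℚᵘ (i ℤ.* j) 0) ⟩
  ℚᵘ.mkℚᵘ i 0 ℚᵘ.* ℚᵘ.mkℚᵘ j 0          ≈⟨ ℚᵘₚ.*-cong (ℚₚ.toℚᵘ-fromℚᵘ (ℚᵘ.mkℚᵘ i 0)) (ℚₚ.toℚᵘ-fromℚᵘ (ℚᵘ.mkℚᵘ j 0)) ⟨
  toℚᵘ (fromℤ i) ℚᵘ.* toℚᵘ (fromℤ j)    ≈⟨ ℚₚ.toℚᵘ-homo-* (fromℤ i) (fromℤ j) ⟨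
  toℚᵘ (fromℤ i * fromℤ j)              ∎)
  where open import Relation.Binary.Reasoning.Setoid ℚᵘₚ.≃-setoid

-- Cross-multiplication: reduces the rational equation of the theorem to an integer identity.
fromℤ-÷ : ∀ i j k l .{{_ : ℚ.NonZero (fromℤ l)}} →
          i ℤ.* l ≡ j ℤ.* k → fromℤ i ≡ fromℤ j * (fromℤ k ÷ fromℤ l)
fromℤ-÷ i j k l il≡jk = begin
  fromℤ i                                ≡⟨ ℚₚ.*-identityʳ (fromℤ i) ⟨
  fromℤ i * ℚ.1ℚ                         ≡⟨ cong (fromℤ i *_) (ℚₚ.*-inverseʳ (fromℤ l)) ⟨
  fromℤ i * (fromℤ l * 1/ fromℤ l)       ≡⟨ ℚₚ.*-assoc (fromℤ i) (fromℤ l) (1/ fromℤ l) ⟨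
  fromℤ i * fromℤ l * 1/ fromℤ l         ≡⟨ cong (_* 1/ fromℤ l) (fromℤ-* i l) ⟨
  fromℤ (i ℤ.* l) * 1/ fromℤ l           ≡⟨ cong (λ m → fromℤ m * 1/ fromℤ l) il≡jk ⟩
  fromℤ (j ℤ.* k) * 1/ fromℤ l           ≡⟨ cong (_* 1/ fromℤ l) (fromℤ-* j k) ⟩
  fromℤ j * fromℤ k * 1/ fromℤ l         ≡⟨ ℚₚ.*-assoc (fromℤ j) (fromℤ k) (1/ fromℤ l) ⟩
  fromℤ j * (fromℤ k ÷ fromℤ l)          ∎
  where open ≡-Reasoning

-- Splitting the two degrees and checking the ratio.

-- The thresholds of `parity-split` with both parts positive, stored as predecessors because
-- `Construction` takes the layer counts in that form.
record MajoritySplit (k n : ℕ) : Set where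
  field
    q r i : ℕ
    n≡    : suc q + suc r ≡ n
    q+i≡  : suc q + i ≡ suc (k + suc r)
    i≤1   : i ≤ 1
    I≡    : I k n ≡ + i

  majority-≥ : k + suc r ≤ suc q
  majority-≥ = ℕ.s≤s⁻¹ (begin
    suc (k + suc r)    ≡⟨ q+i≡ ⟨
    suc q + i          ≤⟨ ℕₚ.+-monoʳ-≤ (suc q) i≤1 ⟩
    suc q + 1          ≡⟨ ℕₚ.+-comm (suc q) 1 ⟩
    suc (suc q)        ∎)
    where open ℕₚ.≤-Reasoning

  majority-≤ : suc q ≤ suc (suc r + k)
  majority-≤ = begin
    suc q              ≤⟨ ℕₚ.m≤m+n (suc q) i ⟩
    suc q + i          ≡⟨ q+i≡ ⟩
    suc (k + suc r)    ≡⟨ cong suc (ℕₚ.+-comm k (suc r)) ⟩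
    suc (suc r + k)    ∎
    where open ℕₚ.≤-Reasoning

-- A zero positive threshold would force `k = 0`, against `1 ≤ k`; a zero negative threshold would
-- force `n ≤ k + 1`, against `k + 2 ≤ n`.
majoritySplit : ∀ k n → 1 ≤ k → k + 2 ≤ n → MajoritySplit k n
majoritySplit k n 1≤k k+2≤n with parity-split k n (ℕₚ.m+n≤o⇒m≤o k k+2≤n)
... | zero , r , i , n≡ , refl , s≤s k+r≤0 , I≡ =
  contradiction (ℕₚ.≤-trans 1≤k (ℕₚ.m+n≤o⇒m≤o k k+r≤0)) (λ ())
... | suc q , zero , i , refl , q+i≡ , i≤1 , I≡ = contradiction (begin-strict
    k + 1              <⟨ ℕₚ.+-monoʳ-< k (ℕₚ.n<1+n 1) ⟩
    k + 2              ≤⟨ k+2≤n ⟩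
    suc q + 0          ≤⟨ ℕₚ.+-monoʳ-≤ (suc q) z≤n ⟩
    suc q + i          ≡⟨ q+i≡ ⟩
    suc (k + 0)        ≡⟨ ℕₚ.+-suc k 0 ⟨
    k + 1              ∎) (ℕₚ.<-irrefl refl)
  where open ℕₚ.≤-Reasoning
... | suc q , suc r , i , n≡ , q+i≡ , i≤1 , I≡ = record
  { q = q ; r = r ; i = i ; n≡ = n≡ ; q+i≡ = q+i≡ ; i≤1 = i≤1 ; I≡ = I≡ }

-- Eliminating `s` and `q` gives `δ = 2a + i - 1 - k` and `Δ = 2b + k + 1 - j`. The denominator
-- becomes `2(a + b)` and the numerator `2(a - b)`, so both sides equal `2t(a - b)(a + b)`.
ratio-identity : ∀ {k δ Δ a s i q b j} t →
  a + s ≡ δ → a + i ≡ suc (k + s) → I k δ ≡ + i →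
  q + b ≡ Δ → q + j ≡ suc (k + b) → I k Δ ≡ + j →
  (t ℕ.* a ⊖ t ℕ.* b) ℤ.* denominator k δ Δ ≡ + (t ℕ.* a + t ℕ.* b) ℤ.* numerator k δ Δ
ratio-identity {k} {δ} {Δ} {a} {s} {i} {q} {b} {j} t refl a+i≡ Iδ≡ refl q+j≡ IΔ≡
  rewrite Iδ≡ | IΔ≡ = begin
    (t ℕ.* a ⊖ t ℕ.* b) ⊠ (+ (a + s) ⊞ + (q + b) ⊞ + j - + i)
      ≡⟨ cong₂ _⊠_ difference≡ (cong₂ (λ x y → x ⊞ y ⊞ + j - + i) δ≡ Δ≡) ⟩
    (+ t ⊠ + a - + t ⊠ + b) ⊠ (δ′ ⊞ Δ′ ⊞ + j - + i)
      ≡⟨ identity (+ t) (+ a) (+ b) (+ i) (+ j) (+ k) ⟩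
    (+ t ⊠ + a ⊞ + t ⊠ + b) ⊠ (δ′ - Δ′ ⊞ + 2 ⊠ + k ⊞ + 2 - + i - + j)
      ≡⟨ cong₂ _⊠_ (cong₂ _⊞_ (ℤₚ.pos-* t a) (ℤₚ.pos-* t b))
                   (cong₂ (λ x y → x - y ⊞ + 2 ⊠ + k ⊞ + 2 - + i - + j) δ≡ Δ≡) ⟨
    + (t ℕ.* a + t ℕ.* b) ⊠ (+ (a + s) - + (q + b) ⊞ + 2 ⊠ + k ⊞ + 2 - + i - + j)
      ∎
  where
  open ≡-Reasoning
  open import Data.Integer.Base using (_-_) renaming (_+_ to infixl 6 _⊞_; _*_ to infixl 7 _⊠_)

  δ′ Δ′ : ℤ
  δ′ = + a ⊞ (+ a ⊞ + i - + 1 - + k)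
  Δ′ = + 1 ⊞ (+ k ⊞ + b) - + j ⊞ + b

  difference≡ : t ℕ.* a ⊖ t ℕ.* b ≡ + t ⊠ + a - + t ⊠ + b
  difference≡ = trans (sym (ℤₚ.m-n≡m⊖n (t ℕ.* a) (t ℕ.* b)))
                      (cong₂ _-_ (ℤₚ.pos-* t a) (ℤₚ.pos-* t b))

  cancel-1+k : ∀ k s → + 1 ⊞ (k ⊞ s) - + 1 - k ≡ s
  cancel-1+k = ℤ-Solver.solve-∀

  cancel-j : ∀ q j → q ⊞ j - j ≡ q
  cancel-j = ℤ-Solver.solve-∀

  δ≡ : + (a + s) ≡ δ′
  δ≡ = cong (+ a ⊞_) (trans (sym (cancel-1+k (+ k) (+ s))) (cong (λ x → + x - + 1 - + k) (sym a+i≡)))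

  Δ≡ : + (q + b) ≡ Δ′
  Δ≡ = cong (_⊞ + b) (trans (sym (cancel-j (+ q) (+ j))) (cong (λ x → + x - + j) q+j≡))

  identity : ∀ t a b i j k →
    let δ = a ⊞ (a ⊞ i - + 1 - k)
        Δ = + 1 ⊞ (k ⊞ b) - j ⊞ b
    in (t ⊠ a - t ⊠ b) ⊠ (δ ⊞ Δ ⊞ j - i) ≡
       (t ⊠ a ⊞ t ⊠ b) ⊠ (δ - Δ ⊞ + 2 ⊠ k ⊞ + 2 - i - j)
  identity = ℤ-Solver.solve-∀

-- Assembling the infinite family.

theorem7 : (k δ Δ : ℕ) → 1 ≤ k → (k+2≤δ : k + 2 ≤ δ) → (δ≤Δ : δ ≤ Δ) →
    Σ[ F ∈ (ℕ → Graph) ]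
    (∀ i j → i ≢ j → ¬ (F i ≅ F j)) ×
    (∀ i → HasMinDegree (F i) δ × HasMaxDegree (F i) Δ ×
    (∃[ γ ] IsSignedTotalDominationNumber k (F i) γ ×
    fromℤ γ ≡
    fromℤ (+ Graph.order (F i)) *
    _÷_ (fromℤ (numerator k δ Δ)) (fromℤ (denominator k δ Δ))
    {{denominator-nonZero k δ Δ k+2≤δ δ≤Δ}}))
theorem7 k δ Δ 1≤k k+2≤δ δ≤Δ =
  F.graph ,
  (λ i j i≢j → i≢j ∘ graph-injective δ.q Δ.r (suc Δ.q) (suc δ.r)) ,
  λ i →
    F.hasMinDegree i δ.n≡ Δ.n≡ δ≤Δ ,
    F.hasMaxDegree i δ.n≡ Δ.n≡ δ≤Δ ,
    γ i ,
    F.dominationNumber i δ.n≡ Δ.n≡ δ≤Δ δ.majority-≥ δ.majority-≤ Δ.majority-≥ Δ.majority-≤ ,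
    fromℤ-÷ (γ i) (+ Graph.order (F.graph i)) (numerator k δ Δ) (denominator k δ Δ)
      {{denominator-nonZero k δ Δ k+2≤δ δ≤Δ}}
      (ratio-identity (F.t i) δ.n≡ δ.q+i≡ δ.I≡ Δ.n≡ Δ.q+i≡ Δ.I≡)
  where
  module δ = MajoritySplit (majoritySplit k δ 1≤k k+2≤δ)
  module Δ = MajoritySplit (majoritySplit k Δ 1≤k (ℕₚ.≤-trans k+2≤δ δ≤Δ))
  -- Negative vertices get the split of `δ` and positive ones the split of `Δ`. The remaining
  -- parameter, the number of copies less one, indexes the family.
  module F = Construction δ.q Δ.r (suc Δ.q) (suc δ.r)
  γ : ℕ → ℤ
  γ i = F.t i ℕ.* suc δ.q ⊖ F.t i ℕ.* suc Δ.r
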